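{- Let $d,n \ge 1$ be fixed integers and let $C>0$. There is a constant $c>0$, independent of $q$, such that for every finite field $\mathbb{F}_q$ and every subset $E \subseteq \mathbb{F}_q^d$ which contains at least a proportion $C$ of all translation classes of $n$-configurations in $\mathbb{F}_q^d$, one has $|E| \ge c\, q^{d(1-\frac{1}{n})}$. In particular, a subset $E \subseteq \mathbb{F}_q^2$ of size of order of magnitude less than $q^{4/3}$ does not contain a positive proportion of translation classes of triangles in $\mathbb{F}_q^2$.
   Context: An $n$-configuration in $\mathbb{F}_q^d$ is an ordered $n$-tuple $(x_1,\dots,x_n)$ of points of $\mathbb{F}_q^d$; a triangle is a $3$-configuration. Two $n$-configurations are in the same translation class if there is $a \in \mathbb{F}_q^d$ with $y_i = x_i + a$ for all $i$. There are $q^{d(n-1)}$ translation classes. $E$ contains a translation class if some $n$-configuration with all entries in $E$ lies in that class. -}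

module Defs where

open import Level using (Level; _⊔_; suc)
open import Data.Nat.Base as ℕ using (ℕ; zero; NonZero)
open import Data.Integer.Base using (+_; +<+)
open import Data.Fin.Base using (Fin)
open import Data.Product.Base using (Σ; ∃-syntax; _×_; _,_; proj₁; proj₂)
open import Data.Sum.Base using (inj₁; inj₂)
open import Data.Rational.Base as ℚ using (ℚ; 0ℚ; 1ℚ; _/_)
import Data.Rational.Properties as ℚₚ
open import Data.Vec.Functional using (Vector)
import Data.Vec.Functional.Relation.Binary.Equality.Setoid as VecEq
open import Function.Bundles using (Inverse)
open import Algebra.Apartness.Bundles using (HeytingField; HeytingCommutativeRing)
open import Algebra.Bundles using (CommutativeRing)
open import Algebra.Definitions.RawSemiring ℚ.+-*-rawSemiring using (_^_)
open import Relation.Binary.Bundles using (Setoid)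
import Relation.Binary.Construct.On as On
open import Relation.Binary.Definitions using (_Respects_)
open import Relation.Binary.PropositionalEquality as ≡ using (_≡_)
open import Relation.Nullary using (¬_)
open import Relation.Unary using (Pred)

-- A nonnegative real x is given by its Dedekind cut {r ∈ ℚ | 0 < r < x};
-- the empty cut is 0.  The cuts are one-sided and not required to be
-- located.  Classically every cut of this kind is located, so these are
-- exactly the nonnegative reals; constructively they include all
-- nonnegative Dedekind reals.

record ℝ≥0 : Set₁ where
  field
    below    : ℚ → Set
    positive : ∀ {r} → below r → 0ℚ ℚ.< r
    downward : ∀ {r s} → 0ℚ ℚ.< r → r ℚ.< s → below s → below r
    rounded  : ∀ {r} → below r → ∃[ s ] (r ℚ.< s × below s)
    bounded  : ∃[ b ] (∀ {r} → below r → r ℚ.≤ b)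

open ℝ≥0 public using (below)

infix  4 _≤ℝ_ _<ℝ_
infixl 7 _*ℝ_

_≤ℝ_ : ℝ≥0 → ℝ≥0 → Set
x ≤ℝ y = ∀ r → below x r → below y r

_<ℝ_ : ℝ≥0 → ℝ≥0 → Set
x <ℝ y = ∃[ r ] (below y r × ¬ below x r)

fromℕ : ℕ → ℝ≥0
fromℕ k = record
  { below    = λ r → 0ℚ ℚ.< r × r ℚ.< + k / 1
  ; positive = proj₁
  ; downward = λ 0<r r<s (_ , s<k) → 0<r , ℚₚ.<-trans r<s s<k
  ; rounded  = λ (0<r , r<k) → let s , r<s , s<k = ℚₚ.<-dense r<k in
                 s , r<s , ℚₚ.<-trans 0<r r<s , s<k
  ; bounded  = + k / 1 , λ (_ , r<k) → ℚₚ.<⇒≤ r<k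
  }

private
  *-mono-≤ : ∀ {r s u v} → 0ℚ ℚ.< s → r ℚ.≤ u → s ℚ.≤ v → 0ℚ ℚ.< u →
             r ℚ.* s ℚ.≤ u ℚ.* v
  *-mono-≤ {r} {s} {u} {v} 0<s r≤u s≤v 0<u = ℚₚ.≤-trans
    (ℚₚ.*-monoʳ-≤-nonNeg s {{ℚ.nonNegative (ℚₚ.<⇒≤ 0<s)}} r≤u)
    (ℚₚ.*-monoˡ-≤-nonNeg u {{ℚ.nonNegative (ℚₚ.<⇒≤ 0<u)}} s≤v)

  *-mono-< : ∀ {r s u v} → 0ℚ ℚ.< s → r ℚ.< u → s ℚ.< v → 0ℚ ℚ.< u →
             r ℚ.* s ℚ.< u ℚ.* v
  *-mono-< {r} {s} {u} {v} 0<s r<u s<v 0<u = ℚₚ.<-trans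
    (ℚₚ.*-monoˡ-<-pos s {{ℚ.positive 0<s}} r<u)
    (ℚₚ.*-monoʳ-<-pos u {{ℚ.positive 0<u}} s<v)

_*ℝ_ : ℝ≥0 → ℝ≥0 → ℝ≥0
x *ℝ y = record
  { below    = λ t → 0ℚ ℚ.< t ×
                 ∃[ r ] ∃[ s ] (below x r × below y s × t ℚ.≤ r ℚ.* s)
  ; positive = proj₁
  ; downward = λ 0<t t<u (_ , r , s , r<x , s<y , u≤rs) →
                 0<t , r , s , r<x , s<y , ℚₚ.≤-trans (ℚₚ.<⇒≤ t<u) u≤rs
  ; rounded  = λ (0<t , r , s , r<x , s<y , t≤rs) →
      let r′ , r<r′ , r′<x = X.rounded r<x
          s′ , s<s′ , s′<y = Y.rounded s<y
          t<r′s′ = ℚₚ.≤-<-trans t≤rs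
                     (*-mono-< (Y.positive s<y) r<r′ s<s′ (X.positive r′<x))
      in r′ ℚ.* s′ , t<r′s′ , ℚₚ.<-trans 0<t t<r′s′ ,
         r′ , s′ , r′<x , s′<y , ℚₚ.≤-refl
  ; bounded  =
      let b , r≤b = X.bounded
          c , s≤c = Y.bounded
      in b ℚ.* c , λ (_ , r , s , r<x , s<y , t≤rs) → ℚₚ.≤-trans t≤rs
           (*-mono-≤ (Y.positive s<y) (r≤b r<x) (s≤c s<y)
             (ℚₚ.<-≤-trans (X.positive r<x) (r≤b r<x)))
  }
  where
  module X = ℝ≥0 x
  module Y = ℝ≥0 y

private
  0<1 : 0ℚ ℚ.< 1ℚ
  0<1 = ℚ.*<* (+<+ (ℕ.s≤s ℕ.z≤n))

  1≤s^n : ∀ {s} n → 1ℚ ℚ.≤ s → 1ℚ ℚ.≤ s ^ n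
  1≤s^n     zero      1≤s = ℚₚ.≤-refl
  1≤s^n {s} (ℕ.suc n) 1≤s =
    ≡.subst (ℚ._≤ s ^ ℕ.suc n) (ℚₚ.*-identityˡ 1ℚ)
      (*-mono-≤ 0<1 1≤s (1≤s^n n 1≤s) (ℚₚ.<-≤-trans 0<1 1≤s))

  root-bound : ∀ n .{{_ : NonZero n}} {s k} → s ^ n ℚ.≤ k → s ℚ.≤ k ℚ.⊔ 1ℚ
  root-bound (ℕ.suc n) {s} {k} s^n≤k with ℚₚ.≤-total s 1ℚ
  ... | inj₁ s≤1 = ℚₚ.≤-trans s≤1 (ℚₚ.p≤q⊔p k 1ℚ)
  ... | inj₂ 1≤s = ℚₚ.≤-trans s≤s^n (ℚₚ.≤-trans s^n≤k (ℚₚ.p≤p⊔q k 1ℚ))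
    where
    s≤s^n : s ℚ.≤ s ^ ℕ.suc n
    s≤s^n = ≡.subst (ℚ._≤ s ^ ℕ.suc n) (ℚₚ.*-identityʳ s)
      (*-mono-≤ 0<1 ℚₚ.≤-refl (1≤s^n n 1≤s) (ℚₚ.<-≤-trans 0<1 1≤s))

-- q ^[ a / b ] is the real number q^(a/b), i.e. the b-th root of q^a:
-- a positive rational r lies strictly below it exactly when some rational
-- s > r satisfies s^b ≤ q^a.

_^[_/_] : ℕ → ℕ → (b : ℕ) .{{_ : NonZero b}} → ℝ≥0
q ^[ a / b ] = record
  { below    = λ r → 0ℚ ℚ.< r × ∃[ s ] (r ℚ.< s × s ^ b ℚ.≤ + (q ℕ.^ a) / 1)
  ; positive = proj₁
  ; downward = λ 0<r r<r′ (_ , s , r′<s , s^b≤q^a) →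
                 0<r , s , ℚₚ.<-trans r<r′ r′<s , s^b≤q^a
  ; rounded  = λ (0<r , s , r<s , s^b≤q^a) →
      let r′ , r<r′ , r′<s = ℚₚ.<-dense r<s in
      r′ , r<r′ , ℚₚ.<-trans 0<r r<r′ , s , r′<s , s^b≤q^a
  ; bounded  = (+ (q ℕ.^ a) / 1) ℚ.⊔ 1ℚ , λ (_ , s , r<s , s^b≤q^a) →
                 ℚₚ.≤-trans (ℚₚ.<⇒≤ r<s) (root-bound b s^b≤q^a)
  }

-- For a setoid S this counts the equivalence classes of S.

HasCardinality : ∀ {a ℓ} → Setoid a ℓ → ℕ → Set (a ⊔ ℓ)
HasCardinality S k = Inverse S (≡.setoid (Fin k))

-- Classically the tight apartness of a Heyting field is inequality, so that
-- Heyting fields are just fields.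

record FiniteField a ℓ₁ ℓ₂ : Set (suc (a ⊔ ℓ₁ ⊔ ℓ₂)) where
  field
    heytingField : HeytingField a ℓ₁ ℓ₂

  open HeytingField heytingField public
    using (Carrier; _≈_; _+_; -_; 0#; heytingCommutativeRing)
  open HeytingCommutativeRing heytingCommutativeRing public
    using (commutativeRing)
  open CommutativeRing commutativeRing public
    using (setoid)

  field
    order          : ℕ
    hasCardinality : HasCardinality setoid order

module _ {a ℓ₁ ℓ₂} (F : FiniteField a ℓ₁ ℓ₂) where

  open FiniteField F using (Carrier; _≈_; _+_; -_; 0#; commutativeRing; setoid)
  open CommutativeRing commutativeRing
    using (refl; sym; trans; +-cong; +-congʳ; +-assoc; +-identityʳ; -‿inverseʳ)

  Point : ℕ → Set a
  Point d = Vector Carrier d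

  pointSetoid : ℕ → Setoid a ℓ₁
  pointSetoid = VecEq.≋-setoid setoid

  record Subset (d : ℕ) (p : Level) : Set (a ⊔ ℓ₁ ⊔ suc p) where
    field
      Member   : Pred (Point d) p
      respects : Member Respects Setoid._≈_ (pointSetoid d)

    elements : Setoid (a ⊔ p) ℓ₁
    elements = On.setoid (pointSetoid d) (proj₁ {B = Member})

    field
      size           : ℕ
      hasCardinality : HasCardinality elements size

  Configuration : ℕ → ℕ → Set a
  Configuration d n = Vector (Point d) n

  SameTranslationClass : ∀ {d n} → Configuration d n → Configuration d n →
                         Set (a ⊔ ℓ₁)
  SameTranslationClass {d} x y =
    Σ (Point d) λ t → ∀ i j → y i j ≈ x i j + t j

  -- A setoid whose equivalence classes are the translation classes.

  translationClasses : ℕ → ℕ → Setoid a (a ⊔ ℓ₁)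
  translationClasses d n = record
    { Carrier       = Configuration d n
    ; _≈_           = SameTranslationClass
    ; isEquivalence = record
      { refl  = (λ _ → 0#) , λ i j → sym (+-identityʳ _)
      ; sym   = λ (t , y≈x+t) → (λ j → - t j) , λ i j → sym
          (trans (+-congʳ (y≈x+t i j)) (trans (+-assoc _ _ _)
            (trans (+-cong refl (-‿inverseʳ (t j))) (+-identityʳ _))))
      ; trans = λ (t , y≈x+t) (u , z≈y+u) → (λ j → t j + u j) , λ i j →
          trans (z≈y+u i j) (trans (+-congʳ (y≈x+t i j)) (+-assoc _ _ _))
      }
    }

  module _ {d p} (E : Subset d p) where

    ContainsClassOf : ∀ {n} → Configuration d n → Set (a ⊔ ℓ₁ ⊔ p)
    ContainsClassOf {n} x = Σ (Configuration d n) λ y →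
      SameTranslationClass x y × (∀ i → Subset.Member E (y i))

    containedClasses : ℕ → Setoid (a ⊔ ℓ₁ ⊔ p) (a ⊔ ℓ₁)
    containedClasses n =
      On.setoid (translationClasses d n) (proj₁ {B = ContainsClassOf})

    ContainsProportion : ℝ≥0 → ℕ → Set (a ⊔ ℓ₁ ⊔ p)
    ContainsProportion C n = ∃[ k ] ∃[ N ]
      ( HasCardinality (containedClasses n) k
      × HasCardinality (translationClasses d n) N
      × C *ℝ fromℕ N ≤ℝ fromℕ k )

-- Translating a configuration in E so that its first point is the origin
-- shows that there are at least q^(d(n-1)) translation classes, and every
-- class contained in E is represented by one of the |E|^n configurations in
-- E.  Hence C q^(d(n-1)) ≤ |E|^n.  Taking c = min(C, 1) suffices, because
-- then c^n ≤ c ≤ C and no n-th root of C is needed.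

module Submission where

open import Defs
open import Level using (Level)
open import Data.Fin.Base using (Fin; zero; suc; combine; funToFin; finToFun)
open import Data.Fin.Properties
  using (injective⇒≤; nonZeroIndex; funToFin-finToFin; finToFun-funToFin)
open import Data.Integer.Base using (+_)
import Data.Integer.Base as ℤ
import Data.Integer.Properties as ℤₚ
open import Data.Nat.Base as ℕ using (ℕ; zero; suc; _*_; _∸_; _≤_; NonZero)
import Data.Nat.Coprimality as Coprimality
import Data.Nat.Properties as ℕₚ
open import Data.Product.Base using (Σ; ∃-syntax; _×_; _,_; proj₂)
open import Data.Rational.Base as ℚ using (ℚ; mkℚ; 0ℚ; 1ℚ; _/_; 1/_)
import Data.Rational.Properties as ℚₚ
open import Data.Vec.Functional using (_∷_)
import Data.Vec.Functional.Relation.Binary.Equality.Setoid as VecEq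
open import Function.Base using (_∘_)
open import Function.Bundles using (Inverse)
open import Algebra.Bundles using (CommutativeRing)
open import Algebra.Definitions.RawSemiring ℚ.+-*-rawSemiring using (_^_)
import Algebra.Properties.CommutativeSemiring.Exp
  (CommutativeRing.commutativeSemiring ℚₚ.+-*-commutativeRing) as Exp
open import Relation.Binary.Bundles using (Setoid)
open import Relation.Binary.PropositionalEquality as ≡ using (_≡_)
import Relation.Binary.Reasoning.Setoid as SetoidReasoning
open import Relation.Nullary using (¬_; yes; no)

-- Counting equivalence classes of setoids.

module _ {a ℓ} {S : Setoid a ℓ} where

  private
    module S = Setoid S

  module _ {b ℓ′} {T : Setoid b ℓ′} where

    private
      module T = Setoid T

    -- Precomposing with `CS.from` evaluates `f` at one chosen representative per class, so `f` may
    -- take inequivalent values on equivalent arguments. In `containedClasses-≤` it does depend on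
    -- the witness chosen for a class.
    injection⇒≤ : ∀ {k l} → HasCardinality S k → HasCardinality T l →
                  (f : S.Carrier → T.Carrier) →
                  (∀ {x y} → f x T.≈ f y → x S.≈ y) → k ≤ l
    injection⇒≤ {k} {l} cardS cardT f f-injective = injective⇒≤ g-injective
      where
      module CS = Inverse cardS
      module CT = Inverse cardT

      g : Fin k → Fin l
      g = CT.to ∘ f ∘ CS.from

      g-injective : ∀ {i j} → g i ≡ g j → i ≡ j
      g-injective {i} {j} gi≡gj = ≡.trans (≡.sym (CS.strictlyInverseˡ i))
        (CS.inverseˡ (f-injective (T.trans (T.sym (CT.strictlyInverseʳ _))
          (CT.inverseʳ gi≡gj))))

  vector-cardinality : ∀ {k} n → HasCardinality S k →
                       HasCardinality (VecEq.≋-setoid S n) (k ℕ.^ n)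
  vector-cardinality {k} n card = record
    { to        = to
    ; from      = from
    ; to-cong   = to-cong
    ; from-cong = λ { ≡.refl i → S.refl }
    ; inverse   = (λ {i} x≈fromi → ≡.trans (to-cong x≈fromi) (to∘from i))
                , (λ { ≡.refl → from∘to _ })
    }
    where
    module C = Inverse card

    to : (Fin n → S.Carrier) → Fin (k ℕ.^ n)
    to x = funToFin (C.to ∘ x)

    from : Fin (k ℕ.^ n) → Fin n → S.Carrier
    from i = C.from ∘ finToFun i

    -- Vectors are functions compared pointwise, so without extensionality the code of a vector is
    -- compared digit by digit.
    funToFin-cong : ∀ {m} {f g : Fin m → Fin k} → (∀ i → f i ≡ g i) →
                    funToFin f ≡ funToFin g
    funToFin-cong {zero}  f≗g = ≡.refl
    funToFin-cong {suc m} f≗g =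
      ≡.cong₂ combine (f≗g zero) (funToFin-cong (f≗g ∘ suc))

    to-cong : ∀ {x y} → (∀ i → x i S.≈ y i) → to x ≡ to y
    to-cong x≈y = funToFin-cong (λ i → C.to-cong (x≈y i))

    to∘from : ∀ i → to (from i) ≡ i
    to∘from i = ≡.trans
      (funToFin-cong {n} (C.strictlyInverseˡ ∘ finToFun i))
      (funToFin-finToFin {n} i)

    from∘to : ∀ x i → from (to x) i S.≈ x i
    from∘to x i = S.trans
      (C.from-cong (finToFun-funToFin (C.to ∘ x) i)) (C.strictlyInverseʳ (x i))

-- Counting translation classes.

module _ {a ℓ₁ ℓ₂} (F : FiniteField a ℓ₁ ℓ₂) where

  open FiniteField F using (0#; order; commutativeRing)
  open CommutativeRing commutativeRing
    using (_+_; setoid; refl; sym; trans; +-congˡ; +-identityˡ; +-identityʳ)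

  translationClasses-nonZero : ∀ {d n N} →
    HasCardinality (translationClasses F d n) N → NonZero N
  translationClasses-nonZero card =
    nonZeroIndex (Inverse.to card (λ _ _ → 0#))

  translationClasses-≥ : ∀ d n {N} →
    HasCardinality (translationClasses F d (suc n)) N →
    order ℕ.^ (d * n) ≤ N
  translationClasses-≥ d n {N} card = ≡.subst (_≤ N) (ℕₚ.^-*-assoc order d n)
    (injection⇒≤ tails card
      -- Both configurations start at the origin, so comparing their first points forces the
      -- translation `t` to be zero.
      ((λ _ → 0#) ∷_) λ {x} {y} (t , y≈x+t) i j → sym (begin
        y i j        ≈⟨ y≈x+t (suc i) j ⟩
        x i j + t j  ≈⟨ +-congˡ (trans (y≈x+t zero j) (+-identityˡ (t j))) ⟨
        x i j + 0#   ≈⟨ +-identityʳ (x i j) ⟩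
        x i j        ∎))
    where
    open SetoidReasoning setoid
    tails = vector-cardinality n
              (vector-cardinality d (FiniteField.hasCardinality F))

  containedClasses-≤ : ∀ {d p} (E : Subset F d p) n {k} →
    HasCardinality (containedClasses F E n) k →
    k ≤ Subset.size E ℕ.^ n
  containedClasses-≤ {d} E n card =
    injection⇒≤ card (vector-cardinality n (Subset.hasCardinality E))
      -- A contained class is sent to its witness `y` in `E`. Equal witnesses differ by the zero
      -- translation, which links `x` to `x′` through `y` and `y′`.
      (λ (x , y , x~y , y∈E) i → y i , y∈E i)
      λ {(x , y , x~y , _)} {(x′ , y′ , x′~y′ , _)} y≈y′ →
        Classes.trans {x} {y} {x′} x~y
          (Classes.trans {y} {y′} {x′}
            ((λ _ → 0#) , λ i j → trans (sym (y≈y′ i j)) (sym (+-identityʳ _)))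
            (Classes.sym {x′} {y′} x′~y′))
    where
    module Classes = Setoid (translationClasses F d n)

-- Natural numbers and powers in the rationals.

toℚ : ℕ → ℚ
toℚ k = + k / 1

-- `_/_` divides by a gcd that does not reduce for a variable `k`. Rewriting to the constructor form
-- lets order and product compute.
toℚ-mkℚ : ∀ k → toℚ k ≡ mkℚ (+ k) 0 (Coprimality.sym (Coprimality.1-coprimeTo k))
toℚ-mkℚ k = ℚₚ.normalize-coprime (Coprimality.sym (Coprimality.1-coprimeTo k))

toℚ-mono-≤ : ∀ {m n} → m ≤ n → toℚ m ℚ.≤ toℚ n
toℚ-mono-≤ {m} {n} m≤n rewrite toℚ-mkℚ m | toℚ-mkℚ n =
  ℚ.*≤* (ℤₚ.*-monoʳ-≤-nonNeg (+ 1) (ℤ.+≤+ m≤n))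

toℚ-* : ∀ m n → toℚ (m * n) ≡ toℚ m ℚ.* toℚ n
toℚ-* m n rewrite toℚ-mkℚ m | toℚ-mkℚ n =
  ≡.cong (_/ 1) (ℤₚ.pos-* m n)

toℚ-^ : ∀ m n → toℚ (m ℕ.^ n) ≡ toℚ m ^ n
toℚ-^ m zero    = ≡.refl
toℚ-^ m (suc n) = ≡.trans (toℚ-* m (m ℕ.^ n)) (≡.cong (toℚ m ℚ.*_) (toℚ-^ m n))

0≤toℚ : ∀ k → 0ℚ ℚ.≤ toℚ k
0≤toℚ k = toℚ-mono-≤ {0} {k} ℕ.z≤n

0<toℚ : ∀ k .{{_ : NonZero k}} → 0ℚ ℚ.< toℚ k
0<toℚ (suc k) = ℚₚ.<-≤-trans (ℚ.*<* (ℤ.+<+ (ℕ.s≤s ℕ.z≤n)))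
                             (toℚ-mono-≤ {1} {suc k} (ℕ.s≤s ℕ.z≤n))

*-mono-≤ : ∀ {p q r s} → 0ℚ ℚ.≤ p → 0ℚ ℚ.≤ s → p ℚ.≤ q → r ℚ.≤ s →
           p ℚ.* r ℚ.≤ q ℚ.* s
*-mono-≤ {p} {q} {r} {s} 0≤p 0≤s p≤q r≤s = ℚₚ.≤-trans
  (ℚₚ.*-monoˡ-≤-nonNeg p {{ℚ.nonNegative 0≤p}} r≤s)
  (ℚₚ.*-monoʳ-≤-nonNeg s {{ℚ.nonNegative 0≤s}} p≤q)

0≤^ : ∀ {p} n → 0ℚ ℚ.≤ p → 0ℚ ℚ.≤ p ^ n
0≤^ zero    0≤p = 0≤toℚ 1
0≤^ (suc n) 0≤p = *-mono-≤ ℚₚ.≤-refl (0≤^ n 0≤p) 0≤p (0≤^ n 0≤p)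

^-monoˡ-≤ : ∀ {p q} n → 0ℚ ℚ.≤ p → p ℚ.≤ q → p ^ n ℚ.≤ q ^ n
^-monoˡ-≤ zero    0≤p p≤q = ℚₚ.≤-refl
^-monoˡ-≤ (suc n) 0≤p p≤q =
  *-mono-≤ 0≤p (0≤^ n (ℚₚ.≤-trans 0≤p p≤q)) p≤q (^-monoˡ-≤ n 0≤p p≤q)

1^n≤1 : ∀ n → 1ℚ ^ n ℚ.≤ 1ℚ
1^n≤1 zero    = ℚₚ.≤-refl
1^n≤1 (suc n) = ≡.subst (ℚ._≤ 1ℚ) (≡.sym (ℚₚ.*-identityˡ (1ℚ ^ n))) (1^n≤1 n)

-- One factor `p` is kept and the others are bounded by 1.
p^n≤p : ∀ {p} n .{{_ : NonZero n}} → 0ℚ ℚ.≤ p → p ℚ.≤ 1ℚ → p ^ n ℚ.≤ p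
p^n≤p {p} (suc n) 0≤p p≤1 = ≡.subst (p ^ suc n ℚ.≤_) (ℚₚ.*-identityʳ p)
  (*-mono-≤ 0≤p (0≤toℚ 1) ℚₚ.≤-refl
    (ℚₚ.≤-trans (^-monoˡ-≤ n 0≤p p≤1) (1^n≤1 n)))

-- Truncating a cut at 1 and comparing n-th roots.

module _ (x : ℝ≥0) where

  private
    module X = ℝ≥0 x

  -- Density gives a point strictly between `r` and 1, and the smaller of it and `s` serves. The
  -- case `r` = 0 yields positivity of `min1`, the general case its roundedness.
  below-<1 : ∀ {r s} → 0ℚ ℚ.≤ r → r ℚ.< s → r ℚ.< 1ℚ → below x s →
             ∃[ t ] (r ℚ.< t × below x t × t ℚ.< 1ℚ)
  below-<1 {r} {s} 0≤r r<s r<1 s<x with ℚₚ.<-dense r<1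
  ... | t , r<t , t<1 with t ℚₚ.<? s
  ...   | yes t<s = t , r<t , X.downward (ℚₚ.≤-<-trans 0≤r r<t) t<s s<x , t<1
  ...   | no  t≮s = s , r<s , s<x , ℚₚ.≤-<-trans (ℚₚ.≮⇒≥ t≮s) t<1

  min1 : ℝ≥0
  min1 = record
    { below    = λ r → below x r × r ℚ.< 1ℚ
    ; positive = λ (r<x , _) → X.positive r<x
    ; downward = λ 0<r r<s (s<x , s<1) →
                   X.downward 0<r r<s s<x , ℚₚ.<-trans r<s s<1
    ; rounded  = λ (r<x , r<1) →
        let s , r<s , s<x = X.rounded r<x
        in below-<1 (ℚₚ.<⇒≤ (X.positive r<x)) r<s r<1 s<x
    ; bounded  = 1ℚ , λ (_ , r<1) → ℚₚ.<⇒≤ r<1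
    }

  min1-positive : fromℕ 0 <ℝ x → fromℕ 0 <ℝ min1
  min1-positive (s , s<x , _) =
    let t , 0<t , t<min1 = below-<1 ℚₚ.≤-refl (X.positive s<x) (0<toℚ 1) s<x
    in t , t<min1 , λ (_ , t<0) → ℚₚ.<-asym 0<t t<0

  -- The hypothesis applies to `u * N` once this is a product of a rational below `x` and one
  -- strictly below `N`. Roundedness supplies `r > u` below `x`, which leaves room for the second
  -- factor.
  *-fromℕ-< : ∀ {N k u} .{{_ : NonZero N}} → below x u →
              x *ℝ fromℕ N ≤ℝ fromℕ k → u ℚ.* toℚ N ℚ.< toℚ k
  *-fromℕ-< {N} {k} {u} u<x xN≤k with X.rounded u<x
  ... | r , u<r , r<x = proj₂ (xN≤k (u ℚ.* toℚ N)
          ( 0<uN , r , v , r<x , (0<v , v<N) , ℚₚ.≤-reflexive (≡.sym rv≡uN) ))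
    where
    instance
      r-pos : ℚ.Positive r
      r-pos = ℚ.positive (X.positive r<x)

      u-pos : ℚ.Positive u
      u-pos = ℚ.positive (X.positive u<x)

      N-pos : ℚ.Positive (toℚ N)
      N-pos = ℚ.positive (0<toℚ N)

      r-nonZero : ℚ.NonZero r
      r-nonZero = ℚₚ.pos⇒nonZero r

      r-nonNeg : ℚ.NonNegative r
      r-nonNeg = ℚₚ.pos⇒nonNeg r

    -- The quotient `u * N / r`, which is less than `N` because `u < r`.
    v : ℚ
    v = 1/ r ℚ.* (u ℚ.* toℚ N)

    rv≡uN : r ℚ.* v ≡ u ℚ.* toℚ N
    rv≡uN = ≡.trans (≡.sym (ℚₚ.*-assoc r (1/ r) (u ℚ.* toℚ N)))
      (≡.trans (≡.cong (ℚ._* (u ℚ.* toℚ N)) (ℚₚ.*-inverseʳ r))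
        (ℚₚ.*-identityˡ (u ℚ.* toℚ N)))

    0<uN : 0ℚ ℚ.< u ℚ.* toℚ N
    0<uN = ℚₚ.positive⁻¹ _ {{ℚₚ.pos*pos⇒pos u (toℚ N)}}

    0<v : 0ℚ ℚ.< v
    0<v = ℚₚ.*-cancelˡ-<-nonNeg r (≡.subst₂ ℚ._<_
      (≡.sym (ℚₚ.*-zeroʳ r)) (≡.sym rv≡uN) 0<uN)

    v<N : v ℚ.< toℚ N
    v<N = ℚₚ.*-cancelˡ-<-nonNeg r (≡.subst (ℚ._< r ℚ.* toℚ N)
      (≡.sym rv≡uN) (ℚₚ.*-monoˡ-<-pos (toℚ N) u<r))

  root-≤ : ∀ {q a N k s} n .{{_ : NonZero n}} .{{_ : NonZero N}} →
           q ℕ.^ a ≤ N → k ≤ s ℕ.^ n → x *ℝ fromℕ N ≤ℝ fromℕ k →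
           min1 *ℝ (q ^[ a / n ]) ≤ℝ fromℕ s
  root-≤ {q} {a} {N} {k} {s} n q^a≤N k≤s^n xN≤k t
         (0<t , u , v , (u<x , u<1) , (0<v , w , v<w , w^n≤q^a) , t≤uv) =
    -- If `s ≤ t`, then `s ≤ u * v`, and taking n-th powers leads from `s ^ n` back to itself. The
    -- one strict step comes from `*-fromℕ-<`.
    0<t , ℚₚ.≰⇒> λ s≤t → ℚₚ.<-irrefl ≡.refl (begin-strict
      toℚ s ^ n          ≤⟨ ^-monoˡ-≤ n (0≤toℚ s) (ℚₚ.≤-trans s≤t t≤uv) ⟩
      (u ℚ.* v) ^ n      ≡⟨ Exp.^-distrib-* u v n ⟩
      u ^ n ℚ.* v ^ n    ≤⟨ *-mono-≤ (0≤^ n 0≤u) (0≤toℚ N)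
                              (p^n≤p n 0≤u (ℚₚ.<⇒≤ u<1)) v^n≤N ⟩
      u ℚ.* toℚ N        <⟨ *-fromℕ-< {N} {k} u<x xN≤k ⟩
      toℚ k              ≤⟨ toℚ-mono-≤ {k} {s ℕ.^ n} k≤s^n ⟩
      toℚ (s ℕ.^ n)      ≡⟨ toℚ-^ s n ⟩
      toℚ s ^ n          ∎)
    where
    open ℚₚ.≤-Reasoning

    0≤u : 0ℚ ℚ.≤ u
    0≤u = ℚₚ.<⇒≤ (X.positive u<x)

    v^n≤N : v ^ n ℚ.≤ toℚ N
    v^n≤N = ℚₚ.≤-trans (^-monoˡ-≤ n (ℚₚ.<⇒≤ 0<v) (ℚₚ.<⇒≤ v<w))
              (ℚₚ.≤-trans w^n≤q^a (toℚ-mono-≤ {q ℕ.^ a} {N} q^a≤N))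

theorem1p3 : ∀ {a ℓ₁ ℓ₂ p ι : Level} →
    ( ∀ (d n : ℕ) .{{_ : NonZero d}} .{{_ : NonZero n}} →
    ∀ (C : ℝ≥0) → fromℕ 0 <ℝ C →
    Σ ℝ≥0 λ c → fromℕ 0 <ℝ c ×
    ( ∀ (F : FiniteField a ℓ₁ ℓ₂) (E : Subset F d p) →
    ContainsProportion F E C n →
    c *ℝ (FiniteField.order F ^[ (d * (n ∸ 1)) / n ]) ≤ℝ fromℕ (Subset.size E) ) )
    ×
    ( ∀ (I : Set ι) (F : I → FiniteField a ℓ₁ ℓ₂) (E : ∀ i → Subset (F i) 2 p) →
    ( ∀ (ε : ℝ≥0) → fromℕ 0 <ℝ ε →
    ∃[ Q ] ( ∀ i → Q ≤ FiniteField.order (F i) →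
    fromℕ (Subset.size (E i)) <ℝ ε *ℝ (FiniteField.order (F i) ^[ 4 / 3 ]) ) ) →
    ∀ (C : ℝ≥0) → fromℕ 0 <ℝ C →
    ∃[ Q ] ( ∀ i → Q ≤ FiniteField.order (F i) → ¬ ContainsProportion (F i) (E i) C 3 ) )
theorem1p3 {a} {ℓ₁} {ℓ₂} {p} = sizeBound , λ I F E small C 0<C →
  -- The constant `c` itself serves as `ε`. The exponents agree because `2 * (3 ∸ 1)` computes to 4,
  -- so a rational below `c * q^(4/3)` but not below `|E|` contradicts `bound`.
  let c , 0<c , bound = sizeBound 2 3 C 0<C
      Q , small-above-Q = small c 0<c
  in Q , λ i Q≤q proportion →
       let r , r<cq , r≮E = small-above-Q i Q≤q
       in r≮E (bound (F i) (E i) proportion r r<cq)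
  where
  sizeBound : ∀ (d n : ℕ) .{{_ : NonZero d}} .{{_ : NonZero n}} →
    ∀ (C : ℝ≥0) → fromℕ 0 <ℝ C →
    Σ ℝ≥0 λ c → fromℕ 0 <ℝ c ×
      ( ∀ (F : FiniteField a ℓ₁ ℓ₂) (E : Subset F d p) →
        ContainsProportion F E C n →
        c *ℝ (FiniteField.order F ^[ (d * (n ∸ 1)) / n ]) ≤ℝ fromℕ (Subset.size E) )
  -- Matching on `suc m` makes `n ∸ 1` reduce to `m`, the number of points left free once the first
  -- is the origin.
  sizeBound d n@(suc m) C 0<C = min1 C , min1-positive C 0<C ,
    λ F E (k , N , cardE , card , CN≤k) →
      root-≤ C {FiniteField.order F} {d * m} {N} {k} {Subset.size E} n
        {{_}} {{translationClasses-nonZero F {d} {n} card}}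
        (translationClasses-≥ F d m card) (containedClasses-≤ F E n cardE) CN≤k
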